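{- For $n\geq 1$, let $E_n(p,q)=\sum_{\sigma\in\mathcal{Q}_n}p^{\operatorname{odd}(\sigma)}q^{\operatorname{even}(\sigma)}$. Then \[ E_n(p,q)=\sum_{k=0}^n {n\brack k}\,p^k(p+q)^{n-k}. \] In particular, for $n\geq 2$: $E_n(1,1)=(2n-1)!!$, $E_n(p,0)=n!\,p^n$, $E_n(1,-1)=1$ and $E_n(-1,1)=(-1)^n$.
   Context: Let $[n]_2$ be the multiset $\{1,1,2,2,\dots,n,n\}$. A Stirling permutation of order $n$ is a permutation $\sigma=\sigma_1\cdots\sigma_{2n}$ of $[n]_2$ such that for each $i\in[n]$ every entry between the two occurrences of $i$ is greater than $i$; $\mathcal{Q}_n$ is the set of these. A value $k\in[n]$ is an even (resp. odd) indexed entry of $\sigma$ if the first occurrence of $k$ in $\sigma$ is at an even (resp. odd) position; $\operatorname{even}(\sigma)$ and $\operatorname{odd}(\sigma)$ are the numbers of even and odd indexed entries (so $\operatorname{even}(\sigma)+\operatorname{odd}(\sigma)=n$). ${n\brack k}$ denotes the signless Stirling number of the first kind, the number of permutations of $[n]$ with exactly $k$ cycles. -}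

module Defs where

open import Algebra.Bundles using (CommutativeRing)
open import Data.Fin.Base using (Fin; toℕ; _<_)
open import Data.Fin.Properties using (_≟_; _<?_; all?; any?)
open import Data.List.Base as List
  using (List; []; _∷_; length; filter; deduplicate; allFin; cartesianProductWith)
open import Data.Nat.Base as ℕ using (ℕ; zero; suc)
open import Data.Nat.Divisibility using (_∣_; _∣?_)
open import Data.Nat.GeneralisedArithmetic using (iterate)
import Data.Nat.Properties as ℕ
open import Data.Product.Base using (∃; _×_)
open import Data.Vec.Base as Vec using (Vec; lookup; count)
open import Relation.Binary.Definitions using (Decidable)
open import Relation.Binary.PropositionalEquality.Core using (_≡_; _≢_)
open import Relation.Nullary using (¬_; ¬?; _×-dec_; _→-dec_)
open import Relation.Unary as Unary using (Pred)

private variable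
  n l : ℕ

-- The alphabet [n] = {1, …, n} is represented by Fin n, with its order.

words : ∀ n l → List (Vec (Fin n) l)
words n zero    = Vec.[] ∷ []
words n (suc l) = cartesianProductWith Vec._∷_ (allFin n) (words n l)

EachLetterOccurs : ℕ → Vec (Fin n) l → Set
EachLetterOccurs m w = ∀ i → count (_≟ i) w ≡ m

eachLetterOccurs? : ∀ m → Unary.Decidable (EachLetterOccurs {n} {l} m)
eachLetterOccurs? m w = all? λ i → count (_≟ i) w ℕ.≟ m

-- The length is n * 2 rather than 2 * n so that the length for suc n
-- reduces to suc (suc (n * 2)).
Word₂ : ℕ → Set
Word₂ n = Vec (Fin n) (n ℕ.* 2)

-- When each letter occurs exactly twice, positions a < c carrying the same
-- letter are the two occurrences of that letter.
LargerBetween : Word₂ n → Set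
LargerBetween σ =
  ∀ a b c → a < b → b < c → lookup σ a ≡ lookup σ c → lookup σ a < lookup σ b

largerBetween? : Unary.Decidable (LargerBetween {n})
largerBetween? σ = all? λ a → all? λ b → all? λ c →
  (a <? b) →-dec (b <? c) →-dec (lookup σ a ≟ lookup σ c) →-dec
  (lookup σ a <? lookup σ b)

IsStirling : Word₂ n → Set
IsStirling σ = EachLetterOccurs 2 σ × LargerBetween σ

isStirling? : Unary.Decidable (IsStirling {n})
isStirling? σ = eachLetterOccurs? 2 σ ×-dec largerBetween? σ

𝒬 : ∀ n → List (Word₂ n)
𝒬 n = filter isStirling? (words n _)

FirstOccurrence : Vec (Fin n) l → Fin n → Fin l → Set
FirstOccurrence σ k a = lookup σ a ≡ k × (∀ b → b < a → lookup σ b ≢ k)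

firstOccurrence? : (σ : Vec (Fin n) l) → Decidable (FirstOccurrence σ)
firstOccurrence? σ k a =
  (lookup σ a ≟ k) ×-dec all? λ b → (b <? a) →-dec ¬? (lookup σ b ≟ k)

-- Positions are numbered from 1, so index a stands for position suc (toℕ a).
EvenIndexed OddIndexed : Vec (Fin n) l → Pred (Fin n) _
EvenIndexed σ k = ∃ λ a → FirstOccurrence σ k a × 2 ∣ suc (toℕ a)
OddIndexed  σ k = ∃ λ a → FirstOccurrence σ k a × ¬ 2 ∣ suc (toℕ a)

evenIndexed? : (σ : Vec (Fin n) l) → Unary.Decidable (EvenIndexed σ)
evenIndexed? σ k = any? λ a → firstOccurrence? σ k a ×-dec (2 ∣? suc (toℕ a))

oddIndexed? : (σ : Vec (Fin n) l) → Unary.Decidable (OddIndexed σ)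
oddIndexed? σ k = any? λ a → firstOccurrence? σ k a ×-dec ¬? (2 ∣? suc (toℕ a))

even odd : Vec (Fin n) l → ℕ
even {n} σ = length (filter (evenIndexed? σ) (allFin n))
odd  {n} σ = length (filter (oddIndexed? σ) (allFin n))

-- Permutations of [n] in one-line notation: i is sent to lookup π i.
permutations : ∀ n → List (Vec (Fin n) n)
permutations n = filter (eachLetterOccurs? 1) (words n n)

-- A cycle in [n] has at most n elements, so exponents below n suffice.
SameCycle : Vec (Fin n) n → Fin n → Fin n → Set
SameCycle {n} π i j = ∃ λ (m : Fin n) → iterate (lookup π) i (toℕ m) ≡ j

sameCycle? : (π : Vec (Fin n) n) → Decidable (SameCycle π)
sameCycle? π i j = any? λ m → iterate (lookup π) i (toℕ m) ≟ j

-- The list of representatives contains exactly one element of each cycle.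
cycles : Vec (Fin n) n → ℕ
cycles {n} π = length (deduplicate (sameCycle? π) (allFin n))

stirling₁ : ℕ → ℕ → ℕ
stirling₁ n k = length (filter (λ π → cycles π ℕ.≟ k) (permutations n))

infix 10 _!!
_!! : ℕ → ℕ
0 !!           = 1
1 !!           = 1
suc (suc n) !! = suc (suc n) ℕ.* n !!

module StirlingPolynomial {c ℓ} (R : CommutativeRing c ℓ) where
  open CommutativeRing R
  open import Algebra.Properties.Semiring.Exp semiring using (_^_)

  E : ℕ → Carrier → Carrier → Carrier
  E n p q = List.foldr _+_ 0# (List.map (λ σ → p ^ odd σ * q ^ even σ) (𝒬 n))

{-# OPTIONS --safe #-}

-- Inserting the adjacent pair n n at any of the 2n − 1 places of a Stirling
-- permutation of order n − 1 yields every element of 𝒬 n once and shifts the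
-- other letters by 0 or 2 places, so it keeps their parities; n places are odd
-- and n − 1 are even. Hence E n = (p + (n − 1)(p + q)) E (n − 1). The sum of
-- p ^ cycles π * r ^ (n ∸ cycles π) over the permutations π of [n] has the factor
-- p + (n − 1) r: a new element is a fixed point, or it enters one of the existing
-- cycles right after one of n − 1 elements. Take r = p + q.

module Submission where

open import Defs
open import Algebra.Bundles using (CommutativeRing)
import Algebra.Properties.CommutativeSemigroup as CommutativeSemigroup
import Algebra.Properties.Semiring.Exp as Exp
import Algebra.Properties.Semiring.Mult as Mult
import Algebra.Properties.Semiring.Sum as Sum
open import Data.Bool.Base using (true; false; not; if_then_else_)
open import Data.Fin.Base as Fin using (Fin; zero; suc; toℕ; fromℕ; fromℕ<; inject₁)
import Data.Fin.Properties as Fin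
open import Data.Fin.Relation.Unary.Top using (view; ‵fromℕ; ‵inject₁)
open import Data.List.Base as List
  using (List; []; _∷_; _++_; allFin; cartesianProductWith; deduplicate; filter; length)
open import Data.List.Membership.Propositional using (_∈_; lose)
open import Data.List.Membership.Propositional.Properties
  using (∈-allFin; ∈-cartesianProductWith⁺; ∈-cartesianProductWith⁻; ∈-filter⁺; ∈-filter⁻)
open import Data.List.Membership.Propositional.Properties.WithK using (unique∧set⇒bag)
import Data.List.Properties as List
open import Data.List.Relation.Binary.BagAndSetEquality using (∼bag⇒↭)
open import Data.List.Relation.Binary.Permutation.Propositional as ↭ using (_↭_)
open import Data.List.Relation.Unary.All as All using ([]; _∷_)
import Data.List.Relation.Unary.All.Properties as All
open import Data.List.Relation.Unary.AllPairs using (AllPairs; []; _∷_)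
import Data.List.Relation.Unary.AllPairs.Properties as AllPairs
open import Data.List.Relation.Unary.Any using (Any; here; there)
import Data.List.Relation.Unary.Any.Properties as Any
open import Data.List.Relation.Unary.Unique.Propositional using (Unique)
import Data.List.Relation.Unary.Unique.Propositional.Properties as Unique
open import Data.Nat.Base as ℕ using (ℕ; zero; suc; _∸_; s≤s; z≤n; _!)
open import Data.Nat.Divisibility using (_∣_; _∣?_; ∣-refl; ∣m+n∣m⇒∣n; ∣m∣n⇒∣m+n)
open import Data.Nat.GeneralisedArithmetic using (iterate)
open import Data.Nat.Induction using (<-wellFounded)
import Data.Nat.Properties as ℕ
open import Data.Product.Base using (∃; ∃₂; _×_; _,_; proj₁; proj₂)
open import Data.Sum.Base as ⊎ using (_⊎_; inj₁; inj₂)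
open import Data.Vec.Base as Vec using (Vec; []; _∷_; count; lookup; _[_]≔_)
import Data.Vec.Properties as Vec
open import Function.Base using (_∘_; id)
open import Function.Bundles using (_⇔_; mk⇔; Equivalence)
open import Function.Construct.Composition using (_⇔-∘_)
open import Function.Definitions using (Injective)
open import Induction.WellFounded using (Acc; acc)
open import Level using (Level)
open import Relation.Binary.Construct.Closure.ReflexiveTransitive
  using (Star; ε; _◅_; _◅◅_; return; gmap; kleisliStar)
open import Relation.Binary.Definitions using (Decidable; Symmetric; Transitive)
open import Relation.Binary.PropositionalEquality
  using (_≡_; _≢_; refl; sym; trans; cong; cong₂; subst; subst₂; module ≡-Reasoning)
import Relation.Binary.Reasoning.Setoid as SetoidReasoning
open import Relation.Nullary using (¬_; ¬?; Dec; does; yes; no; contradiction)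
open import Relation.Nullary.Decidable using (dec-true; dec-false; does-⇔)
open import Relation.Unary as Unary using (Pred)

open Equivalence using (to; from)

-- The two copies of the largest letter must be adjacent, since an entry between them would have to
-- exceed it; so the pair can always be removed, which is why insertion reaches all of `𝒬`. Both
-- families are filtered from a list of all words, in an order that insertion does not respect, so
-- each bijection is turned into a permutation of lists by comparing the members of two
-- duplicate-free lists. The new element of a permutation is `zero` rather than the largest one
-- because `cycles` counts by `deduplicate`, whose outermost step is at the head of `allFin`: when
-- `zero` joins the cycle of `i`, it becomes the representative and exactly one former
-- representative is filtered out. `SameCycle` bounds its exponents by the size, so symmetry and
-- transitivity are obtained through unbounded reachability, where pigeonhole and injectivity make
-- paths reversible. Both sums equal 1 at order 0. The special values are read off the factor p + (n
-- - 1)(p + q), which becomes 2n - 1 at (1,1), np at (p,0), and p when p + q = 0.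

private variable
  a b p q : Level
  A : Set a
  B : Set b
  k l m n : ℕ

-- Words

words-unique : ∀ n l → Unique (words n l)
words-unique n zero    = [] ∷ []
words-unique n (suc l) = Unique.cartesianProductWith⁺ _∷_ Vec.∷-injective
  (Unique.allFin⁺ n) (words-unique n l)

∈-words : (w : Vec (Fin n) l) → w ∈ words n l
∈-words []      = here refl
∈-words (x ∷ w) = ∈-cartesianProductWith⁺ _∷_ (∈-allFin x) (∈-words w)

-- Both lists are duplicate-free, so having the same members makes them equal as bags. Surjectivity
-- is asked only on words satisfying `Q`; that the preimage satisfies `P` then follows from the
-- equivalence.
filter-words-↭ : {P : Pred (Vec (Fin n) l) p} {Q : Pred (Vec (Fin k) m) q}
  (P? : Unary.Decidable P) (Q? : Unary.Decidable Q) {ys : List A}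
  (f : Vec (Fin n) l → A → Vec (Fin k) m) →
  (∀ {v w y z} → f v y ≡ f w z → v ≡ w × y ≡ z) →
  Unique ys → (∀ y → y ∈ ys) →
  (∀ v y → Q (f v y) ⇔ P v) →
  (∀ {w} → Q w → ∃₂ λ v y → w ≡ f v y) →
  filter Q? (words k m) ↭ cartesianProductWith f (filter P? (words n l)) ys
filter-words-↭ P? Q? {ys} f f-inj ys! ∈-ys Q⇔P f-surj = ∼bag⇒↭
  (unique∧set⇒bag
    (Unique.filter⁺ Q? (words-unique _ _))
    (Unique.cartesianProductWith⁺ f f-inj (Unique.filter⁺ P? (words-unique _ _)) ys!)
    (mk⇔ left right))
  where
  left : ∀ {w} → w ∈ filter Q? (words _ _) → w ∈ cartesianProductWith f (filter P? (words _ _)) ys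
  left w∈ with ∈-filter⁻ Q? {xs = words _ _} w∈
  ... | _ , qw with f-surj qw
  ... | v , y , refl = ∈-cartesianProductWith⁺ f
        (∈-filter⁺ P? (∈-words v) (to (Q⇔P v y) qw)) (∈-ys y)
  right : ∀ {w} → w ∈ cartesianProductWith f (filter P? (words _ _)) ys → w ∈ filter Q? (words _ _)
  right w∈ with ∈-cartesianProductWith⁻ f (filter P? (words _ _)) ys w∈
  ... | v , y , v∈ , _ , refl = ∈-filter⁺ Q? (∈-words _)
        (from (Q⇔P v y) (proj₂ (∈-filter⁻ P? {xs = words _ _} v∈)))

map-injective : {f : A → B} → Injective _≡_ _≡_ f → Injective _≡_ _≡_ (Vec.map {n = l} f)
map-injective f-inj {[]}    {[]}    eq = refl
map-injective f-inj {x ∷ v} {y ∷ w} eq with Vec.∷-injective eq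
... | eq₁ , eq₂ = cong₂ _∷_ (f-inj eq₁) (map-injective f-inj eq₂)

-- Letter counts

module _ {P : Pred A p} (P? : Unary.Decidable P) where

  count-≡0⇒¬lookup : (v : Vec A l) → count P? v ≡ 0 → ∀ i → ¬ P (lookup v i)
  count-≡0⇒¬lookup (x ∷ v) c i px with P? x
  count-≡0⇒¬lookup (x ∷ v) () i       px | yes _
  count-≡0⇒¬lookup (x ∷ v) c  zero    px | no ¬p = ¬p px
  count-≡0⇒¬lookup (x ∷ v) c  (suc i) px | no _  = count-≡0⇒¬lookup v c i px

  count-≡1⇒lookup-unique : (v : Vec A l) → count P? v ≡ 1 →
    ∀ i j → P (lookup v i) → P (lookup v j) → i ≡ j
  count-≡1⇒lookup-unique (x ∷ v) c i j pi pj with P? x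
  count-≡1⇒lookup-unique (x ∷ v) c zero    zero    pi pj | _     = refl
  count-≡1⇒lookup-unique (x ∷ v) c zero    (suc j) pi pj | yes _ =
    contradiction pj (count-≡0⇒¬lookup v (ℕ.suc-injective c) j)
  count-≡1⇒lookup-unique (x ∷ v) c (suc i) j       pi pj | yes _ =
    contradiction pi (count-≡0⇒¬lookup v (ℕ.suc-injective c) i)
  count-≡1⇒lookup-unique (x ∷ v) c zero    (suc j) pi pj | no ¬p = contradiction pi ¬p
  count-≡1⇒lookup-unique (x ∷ v) c (suc i) zero    pi pj | no ¬p = contradiction pj ¬p
  count-≡1⇒lookup-unique (x ∷ v) c (suc i) (suc j) pi pj | no _  =
    cong suc (count-≡1⇒lookup-unique v c i j pi pj)

  count-swap : ∀ x y (v : Vec A l) → count P? (x ∷ y ∷ v) ≡ count P? (y ∷ x ∷ v)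
  count-swap x y v with does (P? x) | does (P? y)
  ... | true  | true  = refl
  ... | true  | false = refl
  ... | false | true  = refl
  ... | false | false = refl

  count-∷-cong : ∀ x {v : Vec A l} {w : Vec A k} → count P? v ≡ count P? w →
    count P? (x ∷ v) ≡ count P? (x ∷ w)
  count-∷-cong x eq with does (P? x)
  ... | true  = cong suc eq
  ... | false = eq

  -- The overwritten letter is put back in front, which avoids subtraction and matches the shape of
  -- `insertZero`.
  count-≔ : (v : Vec A l) (i : Fin l) (y : A) →
    count P? (lookup v i ∷ (v [ i ]≔ y)) ≡ count P? (y ∷ v)
  count-≔ (x ∷ v) zero    y = count-swap x y v
  count-≔ (x ∷ v) (suc i) y = begin
    count P? (lookup v i ∷ x ∷ (v [ i ]≔ y)) ≡⟨ count-swap (lookup v i) x (v [ i ]≔ y) ⟩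
    count P? (x ∷ lookup v i ∷ (v [ i ]≔ y)) ≡⟨ count-∷-cong x {lookup v i ∷ (v [ i ]≔ y)} {y ∷ v} (count-≔ v i y) ⟩
    count P? (x ∷ y ∷ v)                     ≡⟨ count-swap x y v ⟩
    count P? (y ∷ x ∷ v)                     ∎
    where open ≡-Reasoning

  count-map : {Q : Pred B q} (Q? : Unary.Decidable Q) (f : B → A) →
    (∀ y → P (f y) ⇔ Q y) → (v : Vec B l) → count P? (Vec.map f v) ≡ count Q? v
  count-map Q? f P⇔Q []      = refl
  count-map Q? f P⇔Q (x ∷ v) rewrite does-⇔ (P⇔Q x) (P? (f x)) (Q? x) with does (Q? x)
  ... | true  = cong suc (count-map Q? f P⇔Q v)
  ... | false = count-map Q? f P⇔Q v

  count-map-≡0 : (f : B → A) → (∀ y → ¬ P (f y)) → (v : Vec B l) → count P? (Vec.map f v) ≡ 0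
  count-map-≡0 f ¬Pf []      = refl
  count-map-≡0 f ¬Pf (x ∷ v) rewrite dec-false (P? (f x)) (¬Pf x) = count-map-≡0 f ¬Pf v

  count-≡0⇒map : (f : B → A) → (∀ x → ¬ P x → ∃ λ y → x ≡ f y) →
    (w : Vec A l) → count P? w ≡ 0 → ∃ λ v → w ≡ Vec.map f v
  count-≡0⇒map f f-surj []      c = [] , refl
  count-≡0⇒map f f-surj (x ∷ w) c with P? x
  count-≡0⇒map f f-surj (x ∷ w) () | yes _
  ... | no ¬px with f-surj x ¬px | count-≡0⇒map f f-surj w c
  ...   | y , refl | v , refl = y ∷ v , refl

-- Permutations

-- Old elements are renamed by `suc`. Index `zero` makes the new element a fixed point; index
-- `suc i` splices it into a cycle, so that `suc i` goes to `zero` and `zero` goes to the old image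
-- of `i`.
insertZero : Vec (Fin n) n → Fin (suc n) → Vec (Fin (suc n)) (suc n)
insertZero π zero    = zero ∷ Vec.map suc π
insertZero π (suc i) = lookup (Vec.map suc π) i ∷ (Vec.map suc π [ i ]≔ zero)

-- No letter of `Vec.map suc v` is `zero`, so the place of `zero` determines the index; the first
-- equation restores the overwritten letter.
map-suc-≔-injective : (v w : Vec (Fin n) l) (i j : Fin l) →
  lookup (Vec.map Fin.suc v) i ≡ lookup (Vec.map suc w) j →
  (Vec.map Fin.suc v [ i ]≔ zero) ≡ (Vec.map suc w [ j ]≔ zero) → v ≡ w × i ≡ j
map-suc-≔-injective (x ∷ v) (y ∷ w) zero    zero    eq₁ eq₂ with Vec.∷-injective eq₂
... | _ , eq with refl ← eq₁ = cong (x ∷_) (map-injective Fin.suc-injective eq) , refl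
map-suc-≔-injective (x ∷ v) (y ∷ w) zero    (suc j) eq₁ eq₂ with () ← proj₁ (Vec.∷-injective eq₂)
map-suc-≔-injective (x ∷ v) (y ∷ w) (suc i) zero    eq₁ eq₂ with () ← proj₁ (Vec.∷-injective eq₂)
map-suc-≔-injective (x ∷ v) (y ∷ w) (suc i) (suc j) eq₁ eq₂ with Vec.∷-injective eq₂
... | refl , eq with map-suc-≔-injective v w i j eq₁ eq
... | refl , refl = refl , refl

insertZero-injective : ∀ {π ρ : Vec (Fin n) n} {i j} →
  insertZero π i ≡ insertZero ρ j → π ≡ ρ × i ≡ j
insertZero-injective {i = zero} {zero} eq = map-injective Fin.suc-injective (proj₂ (Vec.∷-injective eq)) , refl
insertZero-injective {ρ = ρ} {zero} {suc j} eq
  with () ← trans (proj₁ (Vec.∷-injective eq)) (Vec.lookup-map j suc ρ)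
insertZero-injective {π = π} {i = suc i} {zero} eq
  with () ← trans (sym (proj₁ (Vec.∷-injective eq))) (Vec.lookup-map i suc π)
insertZero-injective {π = π} {ρ} {suc i} {suc j} eq with Vec.∷-injective eq
... | eq₁ , eq₂ with map-suc-≔-injective π ρ i j eq₁ eq₂
... | refl , refl = refl , refl

-- Splicing only rearranges the letters of the fixed-point case, so being a permutation has to be
-- checked only there.
count-insertZero : (π : Vec (Fin n) n) (i k : Fin (suc n)) →
  count (Fin._≟ k) (insertZero π i) ≡ count (Fin._≟ k) (insertZero π zero)
count-insertZero π zero    k = refl
count-insertZero π (suc i) k = count-≔ (Fin._≟ k) (Vec.map suc π) i zero

insertZero-permutation : (π : Vec (Fin n) n) (i : Fin (suc n)) →
  EachLetterOccurs 1 (insertZero π i) ⇔ EachLetterOccurs 1 π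
insertZero-permutation π i = mk⇔
  (λ h k → trans (sym (count-suc k)) (trans (sym (count-insertZero π i (suc k))) (h (suc k))))
  (λ h → λ where
    zero    → trans (count-insertZero π i zero)
                (cong suc (count-map-≡0 (Fin._≟ zero) suc (λ _ ()) π))
    (suc k) → trans (count-insertZero π i (suc k)) (trans (count-suc k) (h k)))
  where
  count-suc : ∀ k → count (Fin._≟ suc k) (Vec.map suc π) ≡ count (Fin._≟ k) π
  count-suc k = count-map (Fin._≟ suc k) (Fin._≟ k) suc (λ _ → mk⇔ Fin.suc-injective (cong suc)) π

≢zero⇒suc : (x : Fin (suc n)) → ¬ x ≡ zero → ∃ λ y → x ≡ suc y
≢zero⇒suc zero    x≢0 = contradiction refl x≢0
≢zero⇒suc (suc y) _   = y , refl

-- This undoes splicing: `suc x` is the image of `zero`, and it returns to the place where `zero`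
-- stands in `w`.
count-zero-≡1⇒≔ : (x : Fin n) (w : Vec (Fin (suc n)) l) → count (Fin._≟ zero) w ≡ 1 →
  ∃₂ λ v i → lookup (Vec.map suc v) i ≡ suc x × w ≡ (Vec.map suc v [ i ]≔ zero)
count-zero-≡1⇒≔ x (zero ∷ w) c
  with count-≡0⇒map (Fin._≟ zero) suc ≢zero⇒suc w (ℕ.suc-injective c)
... | v , refl = x ∷ v , zero , refl , refl
count-zero-≡1⇒≔ x (suc y ∷ w) c with count-zero-≡1⇒≔ x w c
... | v , i , eq , refl = y ∷ v , suc i , eq , refl

insertZero-surjective : {w : Vec (Fin (suc n)) (suc n)} → EachLetterOccurs 1 w →
  ∃₂ λ π i → w ≡ insertZero π i
insertZero-surjective {w = zero ∷ w} h
  with count-≡0⇒map (Fin._≟ zero) suc ≢zero⇒suc w (ℕ.suc-injective (h zero))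
... | π , refl = π , zero , refl
insertZero-surjective {w = suc x ∷ w} h with count-zero-≡1⇒≔ x w (h zero)
... | π , i , eq , refl = π , suc i , cong (_∷ (Vec.map suc π [ i ]≔ zero)) (sym eq)

permutations-suc : ∀ n →
  permutations (suc n) ↭ cartesianProductWith insertZero (permutations n) (allFin (suc n))
permutations-suc n = filter-words-↭ (eachLetterOccurs? 1) (eachLetterOccurs? 1) insertZero
  insertZero-injective (Unique.allFin⁺ _) ∈-allFin insertZero-permutation insertZero-surjective

-- Orbits

-- Paths carry no bound on their length, so they can be concatenated and mapped step by step.
Reach : (Fin n → Fin n) → Fin n → Fin n → Set
Reach f = Star λ i j → f i ≡ j

module _ (f : Fin n → Fin n) where

  Reach-iterate : ∀ i m → Reach f i (iterate f i m)
  Reach-iterate i zero    = ε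
  Reach-iterate i (suc m) = refl ◅ Reach-iterate (f i) m

  Reach⇒iterate : ∀ {i j} → Reach f i j → ∃ λ m → iterate f i m ≡ j
  Reach⇒iterate ε          = 0 , refl
  Reach⇒iterate (refl ◅ r) = let m , eq = Reach⇒iterate r in suc m , eq

  iterate-+ : ∀ i l m → iterate f i (l ℕ.+ m) ≡ iterate f (iterate f i l) m
  iterate-+ i zero    m = refl
  iterate-+ i (suc l) m = iterate-+ (f i) l m

  -- The exponents 0, ..., n give n + 1 iterates among n values.
  iterate-repeats : ∀ i → ∃₂ λ l m → l ℕ.< m × m ℕ.≤ n × iterate f i l ≡ iterate f i m
  iterate-repeats i with Fin.pigeonhole (ℕ.n<1+n n) (iterate f i ∘ toℕ)
  ... | s , t , s<t , eq = toℕ s , toℕ t , s<t , Fin.toℕ≤pred[n] t , eq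

  -- An exponent of at least n runs through a repetition at some s < t; cutting out that loop
  -- reaches the same point with the smaller exponent s + (m - t).
  iterate-shorten : ∀ i m → Acc ℕ._<_ m → ∃ λ (l : Fin n) → iterate f i (toℕ l) ≡ iterate f i m
  iterate-shorten i m (acc rec) with m ℕ.<? n
  ... | yes m<n = fromℕ< m<n , cong (iterate f i) (Fin.toℕ-fromℕ< m<n)
  ... | no  m≮n with iterate-repeats i
  ...   | s , t , s<t , t≤n , eq =
    let l , eq′ = iterate-shorten i (s ℕ.+ (m ∸ t)) (rec shorter) in l , trans eq′ same
    where
    t≤m : t ℕ.≤ m
    t≤m = ℕ.≤-trans t≤n (ℕ.≮⇒≥ m≮n)
    shorter : s ℕ.+ (m ∸ t) ℕ.< m
    shorter = subst (s ℕ.+ (m ∸ t) ℕ.<_) (ℕ.m+[n∸m]≡n t≤m) (ℕ.+-monoˡ-< (m ∸ t) s<t)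
    same : iterate f i (s ℕ.+ (m ∸ t)) ≡ iterate f i m
    same = begin
      iterate f i (s ℕ.+ (m ∸ t))       ≡⟨ iterate-+ i s (m ∸ t) ⟩
      iterate f (iterate f i s) (m ∸ t) ≡⟨ cong (λ j → iterate f j (m ∸ t)) eq ⟩
      iterate f (iterate f i t) (m ∸ t) ≡⟨ iterate-+ i t (m ∸ t) ⟨
      iterate f i (t ℕ.+ (m ∸ t))       ≡⟨ cong (iterate f i) (ℕ.m+[n∸m]≡n t≤m) ⟩
      iterate f i m                     ∎
      where open ≡-Reasoning

  module _ (f-inj : Injective _≡_ _≡_ f) where

    iterate-injective : ∀ m {i j} → iterate f i m ≡ iterate f j m → i ≡ j
    iterate-injective zero    eq = eq
    iterate-injective (suc m) eq = f-inj (iterate-injective m eq)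

    -- Injectivity cancels the first s steps of a repetition at s < t, so `i` itself recurs after t
    -- - s steps.
    Reach-back : ∀ i → Reach f (f i) i
    Reach-back i with iterate-repeats i
    ... | s , t , s<t , _ , eq = subst (Reach f (f i)) (iterate-injective s period) (Reach-iterate (f i) d)
      where
      -- One less than the period t - s, because the path back starts at `f i`.
      d = t ∸ suc s
      period : iterate f (iterate f i (suc d)) s ≡ iterate f i s
      period = begin
        iterate f (iterate f i (suc d)) s ≡⟨ iterate-+ i (suc d) s ⟨
        iterate f i (suc d ℕ.+ s)         ≡⟨ cong (iterate f i) (trans (sym (ℕ.+-suc d s)) (ℕ.m∸n+n≡m s<t)) ⟩
        iterate f i t                     ≡⟨ eq ⟨
        iterate f i s                     ∎
        where open ≡-Reasoning

    Reach-sym : Symmetric (Reach f)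
    Reach-sym ε          = ε
    Reach-sym (refl ◅ r) = Reach-sym r ◅◅ Reach-back _

SameCycle⇔Reach : (π : Vec (Fin n) n) → ∀ i j → SameCycle π i j ⇔ Reach (lookup π) i j
SameCycle⇔Reach π i j = mk⇔
  (λ (m , eq) → subst (Reach (lookup π) i) eq (Reach-iterate (lookup π) i (toℕ m)))
  (λ r → let m , eq = Reach⇒iterate (lookup π) r
             l , eq′ = iterate-shorten (lookup π) i m (<-wellFounded m)
         in l , trans eq′ eq)

permutation-injective : (π : Vec (Fin n) n) → EachLetterOccurs 1 π → Injective _≡_ _≡_ (lookup π)
permutation-injective π π! {i} {j} eq =
  count-≡1⇒lookup-unique (Fin._≟ lookup π i) π (π! (lookup π i)) i j refl (sym eq)

-- Representatives of classes

filter-map : {P : Pred A p} {Q : Pred B q} (P? : Unary.Decidable P) (Q? : Unary.Decidable Q)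
  (f : A → B) → (∀ x → Q (f x) ⇔ P x) →
  ∀ xs → filter Q? (List.map f xs) ≡ List.map f (filter P? xs)
filter-map P? Q? f Q⇔P []       = refl
filter-map P? Q? f Q⇔P (x ∷ xs) rewrite does-⇔ (Q⇔P x) (Q? (f x)) (P? x) with does (P? x)
... | true  = cong (f x ∷_) (filter-map P? Q? f Q⇔P xs)
... | false = filter-map P? Q? f Q⇔P xs

¬-⇔ : {P : Set p} {Q : Set q} → P ⇔ Q → (¬ P) ⇔ (¬ Q)
¬-⇔ P⇔Q = mk⇔ (λ ¬p → ¬p ∘ from P⇔Q) (λ ¬q → ¬q ∘ to P⇔Q)

-- This moves the representatives of the old elements from one permutation to the other: their
-- relations agree after renaming by `suc`.
deduplicate-map : {R : A → A → Set p} {S : B → B → Set q} (R? : Decidable R) (S? : Decidable S)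
  (f : A → B) → (∀ x y → S (f x) (f y) ⇔ R x y) →
  ∀ xs → deduplicate S? (List.map f xs) ≡ List.map f (deduplicate R? xs)
deduplicate-map R? S? f S⇔R []       = refl
deduplicate-map R? S? f S⇔R (x ∷ xs) = cong (f x ∷_) (trans
  (cong (filter (¬? ∘ S? (f x))) (deduplicate-map R? S? f S⇔R xs))
  (filter-map (¬? ∘ R? x) (¬? ∘ S? (f x)) f (λ y → ¬-⇔ (S⇔R x y)) (deduplicate R? xs)))

module _ {R : A → A → Set p} (R? : Decidable R) where

  deduplicate-AllPairs : ∀ xs → AllPairs (λ x y → ¬ R x y) (deduplicate R? xs)
  deduplicate-AllPairs []       = []
  deduplicate-AllPairs (x ∷ xs) =
    All.all-filter (¬? ∘ R? x) (deduplicate R? xs) ∷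
    AllPairs.filter⁺ (¬? ∘ R? x) (deduplicate-AllPairs xs)

  module _ (R-sym : Symmetric R) (R-trans : Transitive R) where

    -- Two elements related to `z` would be related to each other, so pairwise unrelated elements
    -- include at most one of the class of `z`; the `Any` hypothesis supplies one. Hence the filter
    -- drops exactly one element.
    length-filter-class : ∀ z {xs} → AllPairs (λ x y → ¬ R x y) xs → Any (R z) xs →
      suc (length (filter (¬? ∘ R? z) xs)) ≡ length xs
    length-filter-class z {x ∷ xs} (¬Rx ∷ ¬R) i with R? z x
    length-filter-class z {x ∷ xs} (¬Rx ∷ ¬R) i         | yes zx =
      cong (suc ∘ length) (List.filter-all (¬? ∘ R? z)
        (All.map (λ ¬xy zy → ¬xy (R-trans (R-sym zx) zy)) ¬Rx))
    length-filter-class z {x ∷ xs} (¬Rx ∷ ¬R) (here zx) | no ¬zx = contradiction zx ¬zx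
    length-filter-class z {x ∷ xs} (¬Rx ∷ ¬R) (there i) | no _   =
      cong suc (length-filter-class z ¬R i)

-- Cycle counts under insertion of a new element

cycles≤n : (π : Vec (Fin n) n) → cycles π ℕ.≤ n
cycles≤n {n} π = ℕ.≤-trans (List.length-deduplicate (sameCycle? π) (allFin n))
  (ℕ.≤-reflexive (List.length-tabulate id))

-- The endpoints are variables with equations because the next vertex of a path is a successor only
-- up to `Vec.lookup-map`, not by computation.
Reach-fixed : (π : Vec (Fin n) n) → ∀ {x y} → Reach (lookup (insertZero π zero)) x y →
  ∀ {a b} → x ≡ suc a → y ≡ suc b → Reach (lookup π) a b
Reach-fixed π ε          refl refl = ε
Reach-fixed π (refl ◅ r) {a} refl eq = refl ◅ Reach-fixed π r (Vec.lookup-map a suc π) eq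

sameCycle-fixed : (π : Vec (Fin n) n) → ∀ a b →
  SameCycle (insertZero π zero) (suc a) (suc b) ⇔ SameCycle π a b
sameCycle-fixed π a b = mk⇔
  (λ c → from (SameCycle⇔Reach π a b)
    (Reach-fixed π (to (SameCycle⇔Reach (insertZero π zero) (suc a) (suc b)) c) refl refl))
  (λ c → from (SameCycle⇔Reach (insertZero π zero) (suc a) (suc b))
    (gmap suc (λ { {j} refl → Vec.lookup-map j suc π }) (to (SameCycle⇔Reach π a b) c)))

¬sameCycle-fixed : (π : Vec (Fin n) n) → ∀ b → ¬ SameCycle (insertZero π zero) zero (suc b)
¬sameCycle-fixed π b (m , eq) = stays (toℕ m) eq
  where
  stays : ∀ m → iterate (lookup (insertZero π zero)) zero m ≢ suc b
  stays (suc m) eq = stays m eq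

-- The head `zero` is related to no other element, so its filter removes nothing and it counts as
-- one additional cycle.
cycles-fixed : (π : Vec (Fin n) n) → cycles (insertZero π zero) ≡ suc (cycles π)
cycles-fixed {n} π = cong suc (begin
  length (filter Z? (deduplicate S? (List.tabulate suc)))
    ≡⟨ cong (length ∘ filter Z? ∘ deduplicate S?) (List.map-tabulate id suc) ⟨
  length (filter Z? (deduplicate S? (List.map suc (allFin n))))
    ≡⟨ cong (length ∘ filter Z?) (deduplicate-map (sameCycle? π) S? suc (sameCycle-fixed π) (allFin n)) ⟩
  length (filter Z? (List.map suc D))
    ≡⟨ cong length (List.filter-all Z? (All.map⁺ (All.universal (¬sameCycle-fixed π) D))) ⟩
  length (List.map suc D)
    ≡⟨ List.length-map suc D ⟩
  cycles π ∎)
  where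
  open ≡-Reasoning
  S? = sameCycle? (insertZero π zero)
  Z? = ¬? ∘ S? zero
  D  = deduplicate (sameCycle? π) (allFin n)

module _ (π : Vec (Fin n) n) (π! : EachLetterOccurs 1 π) (i : Fin n) where

  private
    π′ = insertZero π (suc i)
    f  = lookup π
    f′ = lookup π′

    f-sym : Symmetric (Reach f)
    f-sym = Reach-sym f (permutation-injective π π!)

    f′-sym : Symmetric (Reach f′)
    f′-sym = Reach-sym f′ (permutation-injective π′ (from (insertZero-permutation π (suc i)) π!))

    f′-zero : f′ zero ≡ suc (f i)
    f′-zero = Vec.lookup-map i suc π

    f′-i : f′ (suc i) ≡ zero
    f′-i = Vec.lookup∘update i (Vec.map suc π) zero

    f′-suc : ∀ {a} → a ≢ i → f′ (suc a) ≡ suc (f a)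
    f′-suc {a} a≢i = trans (Vec.lookup∘update′ a≢i (Vec.map suc π) zero) (Vec.lookup-map a suc π)

    -- zero is identified with its predecessor, so a step of f′ is at most one step of f.
    contract : Fin (suc n) → Fin n
    contract zero    = i
    contract (suc a) = a

    contract-step : ∀ {x y} → f′ x ≡ y → Reach f (contract x) (contract y)
    contract-step {zero}  refl = return (sym (cong contract f′-zero))
    contract-step {suc a} refl with a Fin.≟ i
    ... | yes refl = subst (Reach f i) (sym (cong contract f′-i)) ε
    ... | no  a≢i  = return (sym (cong contract (f′-suc a≢i)))

    Reach-contract : ∀ {x y} → Reach f′ x y → Reach f (contract x) (contract y)
    Reach-contract = kleisliStar contract λ {x} → contract-step {x}

    -- The step out of `i` becomes a detour of two steps through `zero`; all other steps are kept.
    suc-step : ∀ {a b} → f a ≡ b → Reach f′ (suc a) (suc b)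
    suc-step {a} refl with a Fin.≟ i
    ... | yes refl = f′-i ◅ f′-zero ◅ ε
    ... | no  a≢i  = return (f′-suc a≢i)

    Reach-suc : ∀ {a b} → Reach f a b → Reach f′ (suc a) (suc b)
    Reach-suc = kleisliStar suc suc-step

  sameCycle-inserted : ∀ a b → SameCycle π′ (suc a) (suc b) ⇔ SameCycle π a b
  sameCycle-inserted a b = mk⇔
    (from (SameCycle⇔Reach π a b) ∘ Reach-contract
      ∘ to (SameCycle⇔Reach π′ (suc a) (suc b)))
    (from (SameCycle⇔Reach π′ (suc a) (suc b)) ∘ Reach-suc ∘ to (SameCycle⇔Reach π a b))

  sameCycle-zero : ∀ b → SameCycle π′ zero (suc b) ⇔ SameCycle π i b
  sameCycle-zero b = mk⇔
    (from (SameCycle⇔Reach π i b) ∘ Reach-contract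
      ∘ to (SameCycle⇔Reach π′ zero (suc b)))
    -- The single step from `suc i` to `zero` is reversed to get from `zero` into the old cycle.
    (from (SameCycle⇔Reach π′ zero (suc b)) ∘ (f′-sym (return f′-i) ◅◅_) ∘ Reach-suc
      ∘ to (SameCycle⇔Reach π i b))

  -- The head `zero` adds a representative, and its filter removes the one that stood for the cycle
  -- of `i`; the two changes cancel.
  cycles-inserted : cycles π′ ≡ cycles π
  cycles-inserted = begin
    suc (length (filter Z? (deduplicate S? (List.tabulate suc))))
      ≡⟨ cong (suc ∘ length ∘ filter Z? ∘ deduplicate S?) (List.map-tabulate id suc) ⟨
    suc (length (filter Z? (deduplicate S? (List.map suc (allFin n)))))
      ≡⟨ cong (suc ∘ length ∘ filter Z?) (deduplicate-map R? S? suc sameCycle-inserted (allFin n)) ⟩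
    suc (length (filter Z? (List.map suc D)))
      ≡⟨ cong (suc ∘ length) (filter-map I? Z? suc (λ b → ¬-⇔ (sameCycle-zero b)) D) ⟩
    suc (length (List.map Fin.suc (filter I? D)))
      ≡⟨ cong suc (List.length-map suc (filter I? D)) ⟩
    suc (length (filter I? D))
      ≡⟨ length-filter-class R? R-sym R-trans i (deduplicate-AllPairs R? (allFin n))
           (Any.deduplicate⁺ R? (λ xy iy → R-trans iy (R-sym xy))
             (lose (∈-allFin i) (from (SameCycle⇔Reach π i i) ε))) ⟩
    cycles π ∎
    where
    open ≡-Reasoning
    R? = sameCycle? π
    S? = sameCycle? π′
    Z? = ¬? ∘ S? zero
    I? = ¬? ∘ R? i
    D  = deduplicate R? (allFin n)
    R-sym : Symmetric (SameCycle π)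
    R-sym {a} {b} = from (SameCycle⇔Reach π b a) ∘ f-sym ∘ to (SameCycle⇔Reach π a b)
    R-trans : Transitive (SameCycle π)
    R-trans {a} {b} {c} ab bc = from (SameCycle⇔Reach π a c)
      (to (SameCycle⇔Reach π a b) ab ◅◅ to (SameCycle⇔Reach π b c) bc)

-- Insertion of a pair of adjacent equal letters

insertPair : A → Vec A l → Fin (suc l) → Vec A (suc (suc l))
insertPair x v       zero    = x ∷ x ∷ v
insertPair x (y ∷ v) (suc j) = y ∷ insertPair x v j

count-insertPair : {P : Pred A p} (P? : Unary.Decidable P) (x : A) (v : Vec A l) (j : Fin (suc l)) →
  count P? (insertPair x v j) ≡ count P? (x ∷ x ∷ v)
count-insertPair P? x v       zero    = refl
count-insertPair P? x (y ∷ v) (suc j) = begin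
  count P? (y ∷ insertPair x v j) ≡⟨ count-∷-cong P? y {insertPair x v j} {x ∷ x ∷ v} (count-insertPair P? x v j) ⟩
  count P? (y ∷ x ∷ x ∷ v)        ≡⟨ count-swap P? y x (x ∷ v) ⟩
  count P? (x ∷ y ∷ x ∷ v)        ≡⟨ count-∷-cong P? x {y ∷ x ∷ v} {x ∷ y ∷ v} (count-swap P? y x v) ⟩
  count P? (x ∷ x ∷ y ∷ v)        ∎
  where open ≡-Reasoning

-- The new index of an old entry: unchanged before the inserted pair, larger by 2 after it.
shift : Fin (suc l) → Fin l → Fin (suc (suc l))
shift zero    a       = suc (suc a)
shift (suc j) zero    = zero
shift (suc j) (suc a) = suc (shift j a)

-- A view of the indices of the longer word, so that case analysis replaces index arithmetic.
data Position {l} (j : Fin (suc l)) : Fin (suc (suc l)) → Set where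
  first  : Position j (inject₁ j)
  second : Position j (suc j)
  old    : ∀ a → Position j (shift j a)

position : (j : Fin (suc l)) (a : Fin (suc (suc l))) → Position j a
position         zero    zero          = first
position         zero    (suc zero)    = second
position         zero    (suc (suc a)) = old a
position {suc l} (suc j) zero          = old zero
position {suc l} (suc j) (suc a) with position j a
... | first  = first
... | second = second
... | old a  = old (suc a)

shift-mono-< : (j : Fin (suc l)) {a b : Fin l} → a Fin.< b → shift j a Fin.< shift j b
shift-mono-< zero    a<b = s≤s (s≤s a<b)
shift-mono-< (suc j) {zero}  {suc b} a<b = s≤s z≤n
shift-mono-< (suc j) {suc a} {suc b} a<b = s≤s (shift-mono-< j (ℕ.s≤s⁻¹ a<b))

shift-cancel-< : (j : Fin (suc l)) {a b : Fin l} → shift j a Fin.< shift j b → a Fin.< b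
shift-cancel-< zero    a<b = ℕ.s≤s⁻¹ (ℕ.s≤s⁻¹ a<b)
shift-cancel-< (suc j) {zero}  {suc b} a<b = s≤s z≤n
shift-cancel-< (suc j) {suc a} {suc b} a<b = s≤s (shift-cancel-< j (ℕ.s≤s⁻¹ a<b))

toℕ-shift : (j : Fin (suc l)) (a : Fin l) →
  toℕ (shift j a) ≡ toℕ a ⊎ toℕ (shift j a) ≡ suc (suc (toℕ a))
toℕ-shift zero    a       = inj₂ refl
toℕ-shift (suc j) zero    = inj₁ refl
toℕ-shift (suc j) (suc a) = ⊎.map (cong suc) (cong suc) (toℕ-shift j a)

module _ (x : A) where

  lookup-first : (v : Vec A l) (j : Fin (suc l)) → lookup (insertPair x v j) (inject₁ j) ≡ x
  lookup-first v       zero    = refl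
  lookup-first (y ∷ v) (suc j) = lookup-first v j

  lookup-second : (v : Vec A l) (j : Fin (suc l)) → lookup (insertPair x v j) (suc j) ≡ x
  lookup-second v       zero    = refl
  lookup-second (y ∷ v) (suc j) = lookup-second v j

  lookup-shift : (v : Vec A l) (j : Fin (suc l)) (a : Fin l) →
    lookup (insertPair x v j) (shift j a) ≡ lookup v a
  lookup-shift v       zero    a       = refl
  lookup-shift (y ∷ v) (suc j) zero    = refl
  lookup-shift (y ∷ v) (suc j) (suc a) = lookup-shift v j a

inject₁<suc : (j : Fin n) → inject₁ j Fin.< suc j
inject₁<suc j = s≤s (ℕ.≤-reflexive (Fin.toℕ-inject₁ j))

-- LargerBetween for words of any length.
Nested : Vec (Fin n) l → Set
Nested w = ∀ a b c → a Fin.< b → b Fin.< c → lookup w a ≡ lookup w c → lookup w a Fin.< lookup w b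

module _ (x : Fin n) (v : Vec (Fin n) l) (v<x : ∀ a → lookup v a Fin.< x) (j : Fin (suc l)) where

  private
    w = insertPair x v j

    x≢v : ∀ {a} → x ≢ lookup v a
    x≢v {a} x≡ = Fin.<-irrefl (sym x≡) (v<x a)

    -- Only the inserted entries carry `x`, and no index lies strictly between them.
    pair-adjacent : ∀ {a b c : Fin (suc (suc l))} → a Fin.< b → b Fin.< c → lookup w a ≡ x → lookup w c ≢ x
    pair-adjacent {a} {b} {c} a<b b<c a≡x c≡x with position j a | position j c
    ... | old a  | _      = x≢v (trans (sym a≡x) (lookup-shift x v j a))
    ... | _      | old c  = x≢v (trans (sym c≡x) (lookup-shift x v j c))
    ... | first  | first  = ℕ.<-asym a<b b<c
    ... | second | second = ℕ.<-asym a<b b<c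
    ... | second | first  = ℕ.<-asym (ℕ.<-trans a<b b<c) (inject₁<suc j)
    ... | first  | second = ℕ.<⇒≱ a<b (ℕ.≤-trans (ℕ.s≤s⁻¹ b<c) (ℕ.≤-reflexive (sym (Fin.toℕ-inject₁ j))))

  -- Equal ends with an entry between them cannot be the new pair, so they are old. A new entry
  -- between them is larger because `x` exceeds every old letter; an old one is governed by
  -- `Nested v`.
  Nested-insertPair : Nested w ⇔ Nested v
  Nested-insertPair = mk⇔
    (λ h a b c a<b b<c a≡c → subst₂ Fin._<_ (lookup-shift x v j a) (lookup-shift x v j b)
      (h (shift j a) (shift j b) (shift j c) (shift-mono-< j a<b) (shift-mono-< j b<c)
        (trans (lookup-shift x v j a) (trans a≡c (sym (lookup-shift x v j c))))))
    insert
    where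
    insert : Nested v → Nested w
    insert h a b c a<b b<c a≡c with lookup w a Fin.≟ x
    ... | yes a≡x = contradiction (trans (sym a≡c) a≡x) (pair-adjacent a<b b<c a≡x)
    ... | no  a≢x with position j a | position j b | position j c
    ...   | first  | _      | _      = contradiction (lookup-first x v j) a≢x
    ...   | second | _      | _      = contradiction (lookup-second x v j) a≢x
    ...   | old a  | _      | first  = contradiction (trans a≡c (lookup-first x v j)) a≢x
    ...   | old a  | _      | second = contradiction (trans a≡c (lookup-second x v j)) a≢x
    ...   | old a  | first  | old c  =
      subst₂ Fin._<_ (sym (lookup-shift x v j a)) (sym (lookup-first x v j)) (v<x a)
    ...   | old a  | second | old c  =
      subst₂ Fin._<_ (sym (lookup-shift x v j a)) (sym (lookup-second x v j)) (v<x a)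
    ...   | old a  | old b  | old c  =
      subst₂ Fin._<_ (sym (lookup-shift x v j a)) (sym (lookup-shift x v j b))
        (h a b c (shift-cancel-< j a<b) (shift-cancel-< j b<c)
          (trans (sym (lookup-shift x v j a)) (trans a≡c (lookup-shift x v j c))))

  -- Shifting preserves the order of the old entries, and the inserted ones cannot be earlier
  -- occurrences of `k`.
  firstOccurrence-old : ∀ {k} → k ≢ x → ∀ a →
    FirstOccurrence w k (shift j a) ⇔ FirstOccurrence v k a
  firstOccurrence-old {k} k≢x a = mk⇔
    (λ (eq , h) → trans (sym (lookup-shift x v j a)) eq ,
      λ b b<a b≡k → h (shift j b) (shift-mono-< j b<a) (trans (lookup-shift x v j b) b≡k))
    (λ (eq , h) → trans (lookup-shift x v j a) eq , λ b b<a b≡k → before h b b<a b≡k)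
    where
    before : (∀ b → b Fin.< a → lookup v b ≢ k) → ∀ b → b Fin.< shift j a → lookup w b ≢ k
    before h b b<a b≡k with position j b
    ... | first  = k≢x (trans (sym b≡k) (lookup-first x v j))
    ... | second = k≢x (trans (sym b≡k) (lookup-second x v j))
    ... | old b  = h b (shift-cancel-< j b<a) (trans (sym (lookup-shift x v j b)) b≡k)

  firstOccurrence-new : ∀ a → FirstOccurrence w x a ⇔ a ≡ inject₁ j
  firstOccurrence-new a = mk⇔ only λ { refl → lookup-first x v j , before }
    where
    only : FirstOccurrence w x a → a ≡ inject₁ j
    only (eq , h) with position j a
    ... | first  = refl
    ... | second = contradiction (lookup-first x v j) (h (inject₁ j) (inject₁<suc j))
    ... | old a  = contradiction (trans (sym eq) (lookup-shift x v j a)) x≢v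
    before : ∀ b → b Fin.< inject₁ j → lookup w b ≢ x
    before b b<j b≡x with position j b
    ... | first  = ℕ.<-irrefl {toℕ (inject₁ j)} refl b<j
    ... | second = ℕ.<-asym b<j (inject₁<suc j)
    ... | old b  = x≢v (trans (sym b≡x) (lookup-shift x v j b))

module _ (f : Fin m → Fin n) (f-inj : Injective _≡_ _≡_ f) (v : Vec (Fin m) l) where

  Nested-map : (∀ {x y} → (x Fin.< y) ⇔ (f x Fin.< f y)) → Nested (Vec.map f v) ⇔ Nested v
  Nested-map f-mono = mk⇔
    (λ h a b c a<b b<c a≡c → from f-mono (subst₂ Fin._<_ (Vec.lookup-map a f v) (Vec.lookup-map b f v)
      (h a b c a<b b<c (trans (Vec.lookup-map a f v) (trans (cong f a≡c) (sym (Vec.lookup-map c f v)))))))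
    (λ h a b c a<b b<c a≡c → subst₂ Fin._<_ (sym (Vec.lookup-map a f v)) (sym (Vec.lookup-map b f v))
      (to f-mono (h a b c a<b b<c (f-inj
        (trans (sym (Vec.lookup-map a f v)) (trans a≡c (Vec.lookup-map c f v)))))))

  firstOccurrence-map : ∀ k a → FirstOccurrence (Vec.map f v) (f k) a ⇔ FirstOccurrence v k a
  firstOccurrence-map k a = mk⇔
    (λ (eq , h) → f-inj (trans (sym (Vec.lookup-map a f v)) eq) ,
      λ b b<a b≡k → h b b<a (trans (Vec.lookup-map b f v) (cong f b≡k)))
    (λ (eq , h) → trans (Vec.lookup-map a f v) (cong f eq) ,
      λ b b<a b≡k → h b b<a (f-inj (trans (sym (Vec.lookup-map b f v)) b≡k)))

-- Insertion of the largest letter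

inject₁-mono-< : {x y : Fin n} → (x Fin.< y) ⇔ (inject₁ x Fin.< inject₁ y)
inject₁-mono-< {x = x} {y} = mk⇔
  (subst₂ ℕ._<_ (sym (Fin.toℕ-inject₁ x)) (sym (Fin.toℕ-inject₁ y)))
  (subst₂ ℕ._<_ (Fin.toℕ-inject₁ x) (Fin.toℕ-inject₁ y))

inject₁<fromℕ : (x : Fin n) → inject₁ x Fin.< fromℕ n
inject₁<fromℕ {n} x = subst₂ ℕ._<_ (sym (Fin.toℕ-inject₁ x)) (sym (Fin.toℕ-fromℕ n)) (Fin.toℕ<n x)

≢fromℕ⇒inject₁ : (x : Fin (suc n)) → ¬ x ≡ fromℕ n → ∃ λ y → x ≡ inject₁ y
≢fromℕ⇒inject₁ x x≢ with view x
... | ‵fromℕ     = contradiction refl x≢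
... | ‵inject₁ y = y , refl

insertMax : Vec (Fin n) l → Fin (suc l) → Vec (Fin (suc n)) (suc (suc l))
insertMax {n} v j = insertPair (fromℕ n) (Vec.map inject₁ v) j

insertMax-injective : {v w : Vec (Fin n) l} {i j : Fin (suc l)} →
  insertMax v i ≡ insertMax w j → v ≡ w × i ≡ j
insertMax-injective {i = zero}  {zero}  eq =
  map-injective Fin.inject₁-injective (proj₂ (Vec.∷-injective (proj₂ (Vec.∷-injective eq)))) , refl
insertMax-injective {w = _ ∷ _} {zero} {suc j} eq =
  contradiction (proj₁ (Vec.∷-injective eq)) Fin.fromℕ≢inject₁
insertMax-injective {v = _ ∷ _} {i = suc i} {zero} eq =
  contradiction (sym (proj₁ (Vec.∷-injective eq))) Fin.fromℕ≢inject₁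
insertMax-injective {v = _ ∷ _} {_ ∷ _} {suc i} {suc j} eq with Vec.∷-injective eq
... | eq₁ , eq₂ with Fin.inject₁-injective eq₁ | insertMax-injective eq₂
... | refl | refl , refl = refl , refl

-- Letters are stripped from the left until the first copy of the maximum; the next letter must then
-- be the second copy.
Nested⇒insertMax : (w : Vec (Fin (suc n)) (suc (suc l))) → count (Fin._≟ fromℕ n) w ≡ 2 → Nested w →
  ∃₂ λ v j → w ≡ insertMax v j
Nested⇒insertMax {n} {l} (y ∷ w) c h with y Fin.≟ fromℕ n
-- Only one letter remains, too few for two copies.
Nested⇒insertMax {n} {zero}  (y ∷ w) c h | no  y≢ =
  contradiction (subst (ℕ._≤ 1) c (Vec.count≤n (Fin._≟ fromℕ n) w)) λ { (s≤s ()) }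
Nested⇒insertMax {n} {suc l} (y ∷ w) c h | no  y≢
  with ≢fromℕ⇒inject₁ y y≢
     | Nested⇒insertMax w c (λ a b c a<b b<c → h (suc a) (suc b) (suc c) (s≤s a<b) (s≤s b<c))
... | z , refl | v , j , refl = z ∷ v , suc j , refl
Nested⇒insertMax {n} {l} (y ∷ z ∷ w) c h | yes refl with z Fin.≟ fromℕ n
... | yes refl with count-≡0⇒map (Fin._≟ fromℕ n) inject₁ ≢fromℕ⇒inject₁ w
                      (ℕ.suc-injective (ℕ.suc-injective c))
...   | v , refl = v , zero , refl
Nested⇒insertMax {n} {l} (y ∷ z ∷ w) c h | yes refl | no z≢ with occurs w (ℕ.suc-injective c)
  where
  occurs : ∀ {l} (w : Vec (Fin (suc n)) l) → count (Fin._≟ fromℕ n) w ≡ 1 → ∃ λ i → lookup w i ≡ fromℕ n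
  occurs (x ∷ w) c with x Fin.≟ fromℕ n
  ... | yes eq = zero , eq
  ... | no  _  = let i , eq = occurs w c in suc i , eq
-- Here `z` lies between the two copies, so it would have to exceed the maximum.
... | i , eq = contradiction
  (h zero (suc zero) (suc (suc i)) (s≤s z≤n) (s≤s (s≤s z≤n)) (sym eq))
  (ℕ.≤⇒≯ (Fin.≤fromℕ z))

count-insertMax : (k : Fin (suc n)) (v : Vec (Fin n) l) (j : Fin (suc l)) →
  count (Fin._≟ k) (insertMax v j) ≡ count (Fin._≟ k) (fromℕ n ∷ fromℕ n ∷ Vec.map inject₁ v)
count-insertMax {n} k v j = count-insertPair (Fin._≟ k) (fromℕ n) (Vec.map inject₁ v) j

insertMax-stirling : (σ : Word₂ n) (j : Fin (suc (n ℕ.* 2))) →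
  IsStirling (insertMax σ j) ⇔ IsStirling σ
insertMax-stirling {n} σ j = mk⇔
  (λ (c , h) → (λ k → trans (sym (count-old k)) (c (inject₁ k))) , to nested h)
  (λ (c , h) → counts c , from nested h)
  where
  max = fromℕ n
  nested : Nested (insertMax σ j) ⇔ Nested σ
  nested = Nested-map inject₁ Fin.inject₁-injective σ inject₁-mono-< ⇔-∘
    Nested-insertPair max (Vec.map inject₁ σ)
      (λ a → subst (Fin._< max) (sym (Vec.lookup-map a inject₁ σ)) (inject₁<fromℕ (lookup σ a))) j
  count-old : ∀ k → count (Fin._≟ inject₁ k) (insertMax σ j) ≡ count (Fin._≟ k) σ
  count-old k rewrite count-insertMax (inject₁ k) σ j
    | dec-false (max Fin.≟ inject₁ k) Fin.fromℕ≢inject₁ =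
    count-map (Fin._≟ inject₁ k) (Fin._≟ k) inject₁ (λ _ → mk⇔ Fin.inject₁-injective (cong inject₁)) σ
  counts : EachLetterOccurs 2 σ → EachLetterOccurs 2 (insertMax σ j)
  counts c k with view k
  ... | ‵inject₁ k = trans (count-old k) (c k)
  ... | ‵fromℕ rewrite count-insertMax max σ j | dec-true (max Fin.≟ max) refl =
    cong (λ m → suc (suc m)) (count-map-≡0 (Fin._≟ max) inject₁ (λ _ → Fin.fromℕ≢inject₁ ∘ sym) σ)

𝒬-suc : ∀ n → 𝒬 (suc n) ↭ cartesianProductWith insertMax (𝒬 n) (allFin (suc (n ℕ.* 2)))
𝒬-suc n = filter-words-↭ isStirling? isStirling? insertMax insertMax-injective
  (Unique.allFin⁺ _) ∈-allFin insertMax-stirling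
  (λ {w} (c , h) → Nested⇒insertMax w (c (fromℕ n)) h)

-- Parity of first occurrences

indicator : {P : Set p} → Dec P → ℕ
indicator P? = if does P? then 1 else 0

-- The new letter is the last one, whereas `allFin` unfolds from the front.
allFin-suc : ∀ n → allFin (suc n) ≡ List.map inject₁ (allFin n) ++ (fromℕ n ∷ [])
allFin-suc n = trans (go n id) (cong (_++ (fromℕ n ∷ [])) (sym (List.map-tabulate id inject₁)))
  where
  go : ∀ n (f : Fin (suc n) → A) →
    List.tabulate f ≡ List.tabulate (f ∘ inject₁) ++ (f (fromℕ n) ∷ [])
  go zero    f = refl
  go (suc n) f = cong (f zero ∷_) (go n (f ∘ suc))

-- Used for both `even` and `odd`: it separates the contribution of the new letter from that of the
-- old ones.
length-filter-allFin : {P : Pred (Fin (suc n)) p} {Q : Pred (Fin n) q}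
  (P? : Unary.Decidable P) (Q? : Unary.Decidable Q) → (∀ i → P (inject₁ i) ⇔ Q i) →
  length (filter P? (allFin (suc n))) ≡ indicator (P? (fromℕ n)) ℕ.+ length (filter Q? (allFin n))
length-filter-allFin {n} P? Q? P⇔Q = begin
  length (filter P? (allFin (suc n)))
    ≡⟨ cong (length ∘ filter P?) (allFin-suc n) ⟩
  length (filter P? (List.map inject₁ (allFin n) ++ (fromℕ n ∷ [])))
    ≡⟨ cong length (List.filter-++ P? (List.map inject₁ (allFin n)) (fromℕ n ∷ [])) ⟩
  length (filter P? (List.map inject₁ (allFin n)) ++ filter P? (fromℕ n ∷ []))
    ≡⟨ List.length-++ (filter P? (List.map inject₁ (allFin n))) ⟩
  length (filter P? (List.map inject₁ (allFin n))) ℕ.+ length (filter P? (fromℕ n ∷ []))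
    ≡⟨ cong₂ ℕ._+_ init last ⟩
  length (filter Q? (allFin n)) ℕ.+ indicator (P? (fromℕ n))
    ≡⟨ ℕ.+-comm (length (filter Q? (allFin n))) _ ⟩
  indicator (P? (fromℕ n)) ℕ.+ length (filter Q? (allFin n)) ∎
  where
  open ≡-Reasoning
  init : length (filter P? (List.map inject₁ (allFin n))) ≡ length (filter Q? (allFin n))
  init = trans (cong length (filter-map Q? P? inject₁ P⇔Q (allFin n)))
    (List.length-map inject₁ (filter Q? (allFin n)))
  last : length (filter P? (fromℕ n ∷ [])) ≡ indicator (P? (fromℕ n))
  last with does (P? (fromℕ n))
  ... | true  = refl
  ... | false = refl

module _ {Q : Pred ℕ q} (Q-periodic : ∀ m → Q (suc (suc m)) ⇔ Q m)
  (v : Vec (Fin n) l) (j : Fin (suc l)) where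

  private
    v<max : ∀ a → lookup (Vec.map inject₁ v) a Fin.< fromℕ n
    v<max a = subst (Fin._< fromℕ n) (sym (Vec.lookup-map a inject₁ v)) (inject₁<fromℕ (lookup v a))

    Q-shift : ∀ a → Q (toℕ (shift j a)) ⇔ Q (toℕ a)
    Q-shift a with toℕ-shift j a
    ... | inj₁ eq rewrite eq = mk⇔ id id
    ... | inj₂ eq rewrite eq = Q-periodic (toℕ a)

    old⇔ : ∀ k a → FirstOccurrence (insertMax v j) (inject₁ k) (shift j a) ⇔ FirstOccurrence v k a
    old⇔ k a = firstOccurrence-map inject₁ Fin.inject₁-injective v k a ⇔-∘
      firstOccurrence-old (fromℕ n) (Vec.map inject₁ v) v<max j (Fin.fromℕ≢inject₁ ∘ sym) a

  -- An index moves by 0 or 2, which a predicate of period 2 does not notice. Keeping `Q` abstract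
  -- treats even and odd positions at once.
  indexed-old : ∀ k → (∃ λ a → FirstOccurrence (insertMax v j) (inject₁ k) a × Q (toℕ a)) ⇔
    (∃ λ a → FirstOccurrence v k a × Q (toℕ a))
  indexed-old k = mk⇔ remove
    (λ (a , fo , qa) → shift j a , from (old⇔ k a) fo , from (Q-shift a) qa)
    where
    remove : (∃ λ a → FirstOccurrence (insertMax v j) (inject₁ k) a × Q (toℕ a)) →
      ∃ λ a → FirstOccurrence v k a × Q (toℕ a)
    remove (a , fo , qa) with position j a
    ... | old a  = a , to (old⇔ k a) fo , to (Q-shift a) qa
    ... | first  = contradiction (trans (sym (lookup-first _ _ j)) (proj₁ fo)) Fin.fromℕ≢inject₁
    ... | second = contradiction (trans (sym (lookup-second _ _ j)) (proj₁ fo)) Fin.fromℕ≢inject₁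

  indexed-new : (∃ λ a → FirstOccurrence (insertMax v j) (fromℕ n) a × Q (toℕ a)) ⇔ Q (toℕ j)
  indexed-new = mk⇔
    (λ (a , fo , qa) → subst Q (trans (cong toℕ (to (new⇔ a) fo)) (Fin.toℕ-inject₁ j)) qa)
    (λ qj → inject₁ j , from (new⇔ _) refl , subst Q (sym (Fin.toℕ-inject₁ j)) qj)
    where
    new⇔ : ∀ a → FirstOccurrence (insertMax v j) (fromℕ n) a ⇔ a ≡ inject₁ j
    new⇔ = firstOccurrence-new (fromℕ n) (Vec.map inject₁ v) v<max j

2∣2+⇔2∣ : ∀ m → (2 ∣ suc (suc m)) ⇔ (2 ∣ m)
2∣2+⇔2∣ m = mk⇔ (λ d → ∣m+n∣m⇒∣n d ∣-refl) (∣m∣n⇒∣m+n ∣-refl)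

even-insertMax : (v : Vec (Fin n) l) (j : Fin (suc l)) →
  even (insertMax v j) ≡ indicator (2 ∣? suc (toℕ j)) ℕ.+ even v
even-insertMax {n} v j = trans
  (length-filter-allFin (evenIndexed? (insertMax v j)) (evenIndexed? v)
    (indexed-old (2∣2+⇔2∣ ∘ suc) v j))
  (cong (λ d → (if d then 1 else 0) ℕ.+ even v)
    (does-⇔ (indexed-new (2∣2+⇔2∣ ∘ suc) v j)
      (evenIndexed? (insertMax v j) (fromℕ n)) (2 ∣? suc (toℕ j))))

odd-insertMax : (v : Vec (Fin n) l) (j : Fin (suc l)) →
  odd (insertMax v j) ≡ indicator (¬? (2 ∣? suc (toℕ j))) ℕ.+ odd v
odd-insertMax {n} v j = trans
  (length-filter-allFin (oddIndexed? (insertMax v j)) (oddIndexed? v)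
    (indexed-old (¬-⇔ ∘ 2∣2+⇔2∣ ∘ suc) v j))
  (cong (λ d → (if d then 1 else 0) ℕ.+ odd v)
    (does-⇔ (indexed-new (¬-⇔ ∘ 2∣2+⇔2∣ ∘ suc) v j)
      (oddIndexed? (insertMax v j) (fromℕ n)) (¬? (2 ∣? suc (toℕ j)))))

-- Weighted sums

module WeightedSums {c ℓ} (R : CommutativeRing c ℓ) where
  open CommutativeRing R hiding (zero)
    renaming (refl to ≈-refl; sym to ≈-sym; trans to ≈-trans; reflexive to ≈-reflexive)
  open Exp semiring using (_^_; ^-homo-*)
  open Mult semiring using (×-congʳ; ×-congˡ; ×-homo-+; ×-assocˡ; ×-assoc-*; ×-comm-*) renaming (_×_ to _·_)
  open Sum semiring using (sum; sum⁺-syntax; sum-cong-≋; ∑-distrib-+; sum-replicate-zero)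
  open StirlingPolynomial R using (E)
  open CommutativeSemigroup *-commutativeSemigroup
    using (interchange) renaming (x∙yz≈y∙xz to x*yz≈y*xz)
  open CommutativeSemigroup +-commutativeSemigroup using (x∙yz≈y∙xz)
  open SetoidReasoning setoid

  Σ : List A → (A → Carrier) → Carrier
  Σ xs g = List.foldr _+_ 0# (List.map g xs)

  Σ-cong : {g h : A → Carrier} (xs : List A) → (∀ {x} → x ∈ xs → g x ≈ h x) → Σ xs g ≈ Σ xs h
  Σ-cong []       eq = ≈-refl
  Σ-cong (x ∷ xs) eq = +-cong (eq (here refl)) (Σ-cong xs (eq ∘ there))

  Σ-↭ : {xs ys : List A} (g : A → Carrier) → xs ↭ ys → Σ xs g ≈ Σ ys g
  Σ-↭ g ↭.refl         = ≈-refl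
  Σ-↭ g (↭.prep x r)   = +-congˡ (Σ-↭ g r)
  Σ-↭ g (↭.swap x y r) = ≈-trans (x∙yz≈y∙xz _ _ _) (+-congˡ (+-congˡ (Σ-↭ g r)))
  Σ-↭ g (↭.trans r s)  = ≈-trans (Σ-↭ g r) (Σ-↭ g s)

  Σ-++ : (g : A → Carrier) (xs ys : List A) → Σ (xs ++ ys) g ≈ Σ xs g + Σ ys g
  Σ-++ g []       ys = ≈-sym (+-identityˡ _)
  Σ-++ g (x ∷ xs) ys = ≈-trans (+-congˡ (Σ-++ g xs ys)) (≈-sym (+-assoc _ _ _))

  Σ-map-* : (f : A → B) {g : B → Carrier} {t : A → Carrier} (y : Carrier) (xs : List A) →
    (∀ x → g (f x) ≈ t x * y) → Σ (List.map f xs) g ≈ Σ xs t * y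
  Σ-map-* f y []       eq = ≈-sym (zeroˡ y)
  Σ-map-* f y (x ∷ xs) eq = ≈-trans (+-cong (eq x) (Σ-map-* f y xs eq)) (≈-sym (distribʳ y _ _))

  -- The common form of both recurrences: each insertion place contributes a factor independent of
  -- the object. The hypothesis receives `x ∈ xs` so that `cycleSum-suc` can use that the word is a
  -- permutation.
  Σ-cartesianProductWith : {C : Set a} (f : A → B → C) {g : C → Carrier} {h : A → Carrier} {t : B → Carrier}
    (xs : List A) (ys : List B) → (∀ {x} → x ∈ xs → ∀ y → g (f x y) ≈ t y * h x) →
    Σ (cartesianProductWith f xs ys) g ≈ Σ ys t * Σ xs h
  Σ-cartesianProductWith f             []       ys eq = ≈-sym (zeroʳ _)
  Σ-cartesianProductWith f {g} {h} {t} (x ∷ xs) ys eq = begin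
    Σ (List.map (f x) ys ++ cartesianProductWith f xs ys) g
      ≈⟨ Σ-++ g (List.map (f x) ys) _ ⟩
    Σ (List.map (f x) ys) g + Σ (cartesianProductWith f xs ys) g
      ≈⟨ +-cong (Σ-map-* (f x) (h x) ys (eq (here refl)))
           (Σ-cartesianProductWith f xs ys (eq ∘ there)) ⟩
    Σ ys t * h x + Σ ys t * Σ xs h
      ≈⟨ distribˡ _ _ _ ⟨
    Σ ys t * (h x + Σ xs h) ∎

  Σ-allFin-suc : ∀ n (t : Fin (suc n) → Carrier) → Σ (allFin (suc n)) t ≡ t zero + Σ (allFin n) (t ∘ suc)
  Σ-allFin-suc n t = cong (λ xs → t zero + List.foldr _+_ 0# xs)
    (trans (List.map-tabulate suc t) (sym (List.map-tabulate id (t ∘ suc))))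

  Σ-allFin-const : ∀ n x → Σ (allFin n) (λ _ → x) ≈ n · x
  Σ-allFin-const zero    x = ≈-refl
  Σ-allFin-const (suc n) x = ≈-trans (≈-reflexive (Σ-allFin-suc n (λ _ → x))) (+-congˡ (Σ-allFin-const n x))

  -- Recurrence for the Stirling permutation polynomial

  positionWeight : Carrier → Carrier → ℕ → Carrier
  positionWeight p q m = p ^ indicator (¬? (2 ∣? suc m)) * q ^ indicator (2 ∣? suc m)

  positionWeight-periodic : ∀ p q m → positionWeight p q (suc (suc m)) ≡ positionWeight p q m
  positionWeight-periodic p q m = cong
    (λ d → p ^ (if not d then 1 else 0) * q ^ (if d then 1 else 0))
    (does-⇔ (2∣2+⇔2∣ (suc m)) (2 ∣? suc (suc (suc m))) (2 ∣? suc m))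

  -- The weights alternate p, q, p, ..., p. Each increase of `n` adds two places, one of each
  -- parity, hence one more p + q.
  Σ-positionWeight : ∀ p q n →
    Σ (allFin (suc (n ℕ.* 2))) (positionWeight p q ∘ toℕ) ≈ p + n · (p + q)
  Σ-positionWeight p q zero    = +-congʳ (≈-trans (*-identityʳ _) (*-identityʳ _))
  Σ-positionWeight p q (suc n) = begin
    Σ (allFin (suc (suc (suc (n ℕ.* 2))))) (w ∘ toℕ)
      ≡⟨ Σ-allFin-suc (suc (suc (n ℕ.* 2))) (w ∘ toℕ) ⟩
    w 0 + Σ (allFin (suc (suc (n ℕ.* 2)))) (λ i → w (suc (toℕ i)))
      ≡⟨ cong (w 0 +_) (Σ-allFin-suc (suc (n ℕ.* 2)) (λ i → w (suc (toℕ i)))) ⟩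
    w 0 + (w 1 + Σ (allFin (suc (n ℕ.* 2))) (λ i → w (suc (suc (toℕ i)))))
      ≈⟨ +-cong (≈-trans (*-identityʳ _) (*-identityʳ _)) (+-cong (≈-trans (*-identityˡ _) (*-identityʳ _))
           (Σ-cong (allFin (suc (n ℕ.* 2))) (λ {i} _ → ≈-reflexive (positionWeight-periodic p q (toℕ i))))) ⟩
    p + (q + Σ (allFin (suc (n ℕ.* 2))) (w ∘ toℕ))
      ≈⟨ +-congˡ (+-congˡ (Σ-positionWeight p q n)) ⟩
    p + (q + (p + n · (p + q)))
      ≈⟨ +-congˡ (≈-trans (x∙yz≈y∙xz q p _) (≈-sym (+-assoc p q _))) ⟩
    p + suc n · (p + q) ∎
    where w = positionWeight p q

  E-suc : ∀ n p q → E (suc n) p q ≈ (p + n · (p + q)) * E n p q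
  E-suc n p q = begin
    Σ (𝒬 (suc n)) weight
      ≈⟨ Σ-↭ weight (𝒬-suc n) ⟩
    Σ (cartesianProductWith insertMax (𝒬 n) (allFin (suc (n ℕ.* 2)))) weight
      ≈⟨ Σ-cartesianProductWith insertMax (𝒬 n) (allFin (suc (n ℕ.* 2))) (λ {σ} _ j → step σ j) ⟩
    Σ (allFin (suc (n ℕ.* 2))) (positionWeight p q ∘ toℕ) * Σ (𝒬 n) weight
      ≈⟨ *-congʳ (Σ-positionWeight p q n) ⟩
    (p + n · (p + q)) * Σ (𝒬 n) weight ∎
    where
    weight : Vec (Fin k) l → Carrier
    weight σ = p ^ odd σ * q ^ even σ
    step : (σ : Word₂ n) (j : Fin (suc (n ℕ.* 2))) →
      weight (insertMax σ j) ≈ positionWeight p q (toℕ j) * weight σ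
    step σ j = begin
      p ^ odd (insertMax σ j) * q ^ even (insertMax σ j)
        ≡⟨ cong₂ (λ o e → p ^ o * q ^ e) (odd-insertMax σ j) (even-insertMax σ j) ⟩
      p ^ (o ℕ.+ odd σ) * q ^ (e ℕ.+ even σ)
        ≈⟨ *-cong (^-homo-* p o (odd σ)) (^-homo-* q e (even σ)) ⟩
      (p ^ o * p ^ odd σ) * (q ^ e * q ^ even σ)
        ≈⟨ interchange _ _ _ _ ⟩
      (p ^ o * q ^ e) * (p ^ odd σ * q ^ even σ) ∎
      where
      o = indicator (¬? (2 ∣? suc (toℕ j)))
      e = indicator (2 ∣? suc (toℕ j))

  -- Recurrence for the cycle polynomial

  cycleSum : ℕ → Carrier → Carrier → Carrier
  cycleSum n p r = Σ (permutations n) λ π → p ^ cycles π * r ^ (n ∸ cycles π)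

  cycleSum-suc : ∀ n p r → cycleSum (suc n) p r ≈ (p + n · r) * cycleSum n p r
  cycleSum-suc n p r = begin
    Σ (permutations (suc n)) weight
      ≈⟨ Σ-↭ weight (permutations-suc n) ⟩
    Σ (cartesianProductWith insertZero (permutations n) (allFin (suc n))) weight
      ≈⟨ Σ-cartesianProductWith insertZero (permutations n) (allFin (suc n))
           (λ {π} π∈ i → step π (proj₂ (∈-filter⁻ (eachLetterOccurs? 1) {xs = words n n} π∈)) i) ⟩
    Σ (allFin (suc n)) t * cycleSum n p r
      ≈⟨ *-congʳ (≈-trans (≈-reflexive (Σ-allFin-suc n t)) (+-congˡ (Σ-allFin-const n r))) ⟩
    (p + n · r) * cycleSum n p r ∎
    where
    weight : Vec (Fin k) k → Carrier
    weight {k} π = p ^ cycles π * r ^ (k ∸ cycles π)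
    t : Fin (suc n) → Carrier
    t zero    = p
    t (suc _) = r
    step : (π : Vec (Fin n) n) → EachLetterOccurs 1 π → ∀ i → weight (insertZero π i) ≈ t i * weight π
    step π π! zero = begin
      p ^ cycles (insertZero π zero) * r ^ (suc n ∸ cycles (insertZero π zero))
        ≡⟨ cong (λ c → p ^ c * r ^ (suc n ∸ c)) (cycles-fixed π) ⟩
      (p * p ^ cycles π) * r ^ (n ∸ cycles π)
        ≈⟨ *-assoc _ _ _ ⟩
      p * weight π ∎
    step π π! (suc i) = begin
      p ^ cycles (insertZero π (suc i)) * r ^ (suc n ∸ cycles (insertZero π (suc i)))
        ≡⟨ cong (λ c → p ^ c * r ^ (suc n ∸ c)) (cycles-inserted π π! i) ⟩
      p ^ cycles π * r ^ (suc n ∸ cycles π)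
        -- Since `cycles π` is at most `n`, the subtraction is not truncated and the exponent of `r`
        -- grows by one.
        ≡⟨ cong (λ e → p ^ cycles π * r ^ e) (ℕ.+-∸-assoc 1 (cycles≤n π)) ⟩
      p ^ cycles π * (r * r ^ (n ∸ cycles π))
        ≈⟨ x*yz≈y*xz _ _ _ ⟩
      r * weight π ∎

  E≈cycleSum : ∀ n p q → E n p q ≈ cycleSum n p (p + q)
  -- Each sum has only the empty word, and both weights compute to `1# * 1#`.
  E≈cycleSum zero    p q = ≈-refl
  E≈cycleSum (suc n) p q = begin
    E (suc n) p q                              ≈⟨ E-suc n p q ⟩
    (p + n · (p + q)) * E n p q                ≈⟨ *-congˡ (E≈cycleSum n p q) ⟩
    (p + n · (p + q)) * cycleSum n p (p + q)   ≈⟨ cycleSum-suc n p (p + q) ⟨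
    cycleSum (suc n) p (p + q)                 ∎

  -- Grouping permutations by their number of cycles

  ∑-indicator : ∀ n {m} (g : ℕ → Carrier) → m ℕ.≤ n →
    ∑[ k ≤ n ] (indicator (m ℕ.≟ toℕ k) · g (toℕ k)) ≈ g m
  ∑-indicator n       {zero}  g _ = begin
    g 0 + 0# + sum {n} (λ _ → 0#) ≈⟨ +-cong (+-identityʳ _) (sum-replicate-zero n) ⟩
    g 0 + 0#                      ≈⟨ +-identityʳ _ ⟩
    g 0                           ∎
  ∑-indicator (suc n) {suc m} g m≤n = ≈-trans (+-identityˡ _) (∑-indicator n (g ∘ suc) (ℕ.s≤s⁻¹ m≤n))

  length-filter-∷ : {P : Pred A p} (P? : Unary.Decidable P) (x : A) (xs : List A) →
    length (filter P? (x ∷ xs)) ≡ indicator (P? x) ℕ.+ length (filter P? xs)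
  length-filter-∷ P? x xs with does (P? x)
  ... | true  = refl
  ... | false = refl

  -- Each element adds 1 to the multiplicity of its own value and 0 to the others; the bound on `v`
  -- keeps that value inside the range of summation.
  Σ-by-value : (v : A → ℕ) (g : ℕ → Carrier) → (∀ x → v x ℕ.≤ n) → (xs : List A) →
    Σ xs (g ∘ v) ≈ ∑[ k ≤ n ] (length (filter (λ x → v x ℕ.≟ toℕ k) xs) · g (toℕ k))
  Σ-by-value {n = n} v g v≤n []       = ≈-sym (sum-replicate-zero (suc n))
  Σ-by-value {n = n} v g v≤n (x ∷ xs) = begin
    g (v x) + Σ xs (g ∘ v)
      ≈⟨ +-cong (∑-indicator n g (v≤n x)) (≈-sym (Σ-by-value v g v≤n xs)) ⟨
    (∑[ k ≤ n ] (δ k · g (toℕ k))) + (∑[ k ≤ n ] (N k xs · g (toℕ k)))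
      ≈⟨ ∑-distrib-+ (λ k → δ k · g (toℕ k)) (λ k → N k xs · g (toℕ k)) ⟨
    ∑[ k ≤ n ] (δ k · g (toℕ k) + N k xs · g (toℕ k))
      ≈⟨ sum-cong-≋ (λ k → ≈-trans (≈-sym (×-homo-+ (g (toℕ k)) (δ k) (N k xs)))
           (×-congˡ (sym (length-filter-∷ (λ y → v y ℕ.≟ toℕ k) x xs)))) ⟩
    ∑[ k ≤ n ] (N k (x ∷ xs) · g (toℕ k)) ∎
    where
    δ : Fin (suc n) → ℕ
    δ k = indicator (v x ℕ.≟ toℕ k)
    N : Fin (suc n) → List _ → ℕ
    N k ys = length (filter (λ y → v y ℕ.≟ toℕ k) ys)

  E-expansion : ∀ n p q →
    E n p q ≈ ∑[ k ≤ n ] (stirling₁ n (toℕ k) · (p ^ toℕ k * (p + q) ^ (n ∸ toℕ k)))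
  E-expansion n p q = ≈-trans (E≈cycleSum n p q)
    (Σ-by-value cycles (λ k → p ^ k * (p + q) ^ (n ∸ k)) cycles≤n (permutations n))

  -- Special values

  ·-*-· : ∀ m n x y → (m · x) * (n · y) ≈ (m ℕ.* n) · (x * y)
  ·-*-· m n x y = begin
    (m · x) * (n · y)   ≈⟨ ×-assoc-* m x (n · y) ⟩
    m · (x * (n · y))   ≈⟨ ×-congʳ m (×-comm-* n x y) ⟩
    m · (n · (x * y))   ≈⟨ ×-assocˡ (x * y) m n ⟩
    (m ℕ.* n) · (x * y) ∎

  ·-zeroʳ : ∀ n → n · 0# ≈ 0#
  ·-zeroʳ zero    = ≈-refl
  ·-zeroʳ (suc n) = ≈-trans (+-identityˡ _) (·-zeroʳ n)

  1^n≈1 : ∀ n → 1# ^ n ≈ 1#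
  1^n≈1 zero    = ≈-refl
  1^n≈1 (suc n) = ≈-trans (*-identityˡ _) (1^n≈1 n)

  E[0]≈1 : ∀ p q → E 0 p q ≈ 1#
  E[0]≈1 p q = ≈-trans (+-identityʳ _) (*-identityˡ _)

  -- The factors of the recurrence are the successive odd numbers. Starting at `suc n` keeps
  -- truncated subtraction out of the induction.
  E[1,1] : ∀ n → E (suc n) 1# 1# ≈ (suc (n ℕ.* 2) !!) · 1#
  E[1,1] zero    = begin
    E 1 1# 1#                 ≈⟨ E-suc 0 1# 1# ⟩
    (1# + 0#) * E 0 1# 1#     ≈⟨ *-congˡ (E[0]≈1 1# 1#) ⟩
    (1# + 0#) * 1#            ≈⟨ *-identityʳ _ ⟩
    1# + 0#                   ∎
  E[1,1] (suc n) = begin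
    E (suc (suc n)) 1# 1#
      ≈⟨ E-suc (suc n) 1# 1# ⟩
    (1# + suc n · (1# + 1#)) * E (suc n) 1# 1#
      -- Writing `1# + 1#` as twice `1#` lets the nested multiples merge into a single odd multiple
      -- of `1#`.
      ≈⟨ *-cong (+-congˡ (≈-trans (×-congʳ (suc n) (+-congˡ (≈-sym (+-identityʳ 1#))))
           (×-assocˡ 1# (suc n) 2))) (E[1,1] n) ⟩
    (suc (suc n ℕ.* 2) · 1#) * ((suc (n ℕ.* 2) !!) · 1#)
      ≈⟨ ·-*-· (suc (suc n ℕ.* 2)) (suc (n ℕ.* 2) !!) 1# 1# ⟩
    (suc (suc n ℕ.* 2) !!) · (1# * 1#)
      ≈⟨ ×-congʳ (suc (suc n ℕ.* 2) !!) (*-identityˡ 1#) ⟩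
    (suc (suc n ℕ.* 2) !!) · 1# ∎

  -- With q = 0 the factor p + n p is `suc n · p` by definition, so the coefficients multiply to the
  -- factorial.
  E[p,0] : ∀ n p → E n p 0# ≈ (n !) · (p ^ n)
  E[p,0] zero    p = ≈-trans (E[0]≈1 p 0#) (≈-sym (+-identityʳ _))
  E[p,0] (suc n) p = begin
    E (suc n) p 0#                     ≈⟨ E-suc n p 0# ⟩
    (p + n · (p + 0#)) * E n p 0#      ≈⟨ *-cong (+-congˡ (×-congʳ n (+-identityʳ p))) (E[p,0] n p) ⟩
    (suc n · p) * ((n !) · (p ^ n))    ≈⟨ ·-*-· (suc n) (n !) p (p ^ n) ⟩
    (suc n !) · (p ^ suc n)            ∎

  -- When p + q vanishes, every factor of the recurrence is p; this covers both (1, -1) and (-1, 1).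
  E-antidiagonal : ∀ n {p q} → p + q ≈ 0# → E n p q ≈ p ^ n
  E-antidiagonal zero    {p} {q} eq = E[0]≈1 p q
  E-antidiagonal (suc n) {p} {q} eq = begin
    E (suc n) p q                ≈⟨ E-suc n p q ⟩
    (p + n · (p + q)) * E n p q  ≈⟨ *-cong (+-congˡ (≈-trans (×-congʳ n eq) (·-zeroʳ n))) (E-antidiagonal n eq) ⟩
    (p + 0#) * p ^ n             ≈⟨ *-congʳ (+-identityʳ p) ⟩
    p ^ suc n                    ∎

theorem4 : ∀ {c ℓ} (R : CommutativeRing c ℓ) →
  let open CommutativeRing R
      open Exp semiring using (_^_)
      open Mult semiring using () renaming (_×_ to _·_)
      open Sum semiring using (sum⁺-syntax)
      open StirlingPolynomial R using (E)
  in
  (∀ n → 1 ℕ.≤ n → ∀ (p q : Carrier) →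
    E n p q ≈ ∑[ k ≤ n ] (stirling₁ n (toℕ k) · (p ^ toℕ k * (p + q) ^ (n ∸ toℕ k)))) ×
  (∀ n → 2 ℕ.≤ n →
    (E n 1# 1# ≈ ((2 ℕ.* n ∸ 1) !!) · 1#) ×
    (∀ (p : Carrier) → E n p 0# ≈ (n !) · (p ^ n)) ×
    (E n 1# (- 1#) ≈ 1#) ×
    (E n (- 1#) 1# ≈ (- 1#) ^ n))
theorem4 R = (λ n _ → E-expansion n) , λ where
    (suc n) _ →
      -- After commuting the product, `suc n * 2 ∸ 1` computes to `suc (n * 2)`.
      ≈-trans (E[1,1] n) (×-congˡ (cong (λ m → (m ∸ 1) !!) (ℕ.*-comm (suc n) 2))) ,
      E[p,0] (suc n) ,
      ≈-trans (E-antidiagonal (suc n) (-‿inverseʳ 1#)) (1^n≈1 (suc n)) ,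
      E-antidiagonal (suc n) (-‿inverseˡ 1#)
  where
  open CommutativeRing R using (1#; -‿inverseʳ; -‿inverseˡ; semiring) renaming (trans to ≈-trans)
  open Mult semiring using (×-congˡ)
  open WeightedSums R
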